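{- It is decidable whether a given regular forest language $L\subseteq H_A$ (given, for instance, by a bottom-up deterministic automaton, or equivalently by a homomorphism into a finite forest algebra together with an accepting subset of its horizontal monoid) is locally testable.
   Context: Forest algebras. A forest algebra $(H,V)$ consists of a commutative monoid $H$ (additive, identity $0$), a monoid $V$, and a faithful right action $H\times V\to H$ such that for $v\in V$, $h\in H$ there is $v+h\in V$ with $g(v+h)=gv+h$ for all $g\in H$. Free forest algebra. For a finite alphabet $A$, $A^{\Delta}=(H_A,V_A)$: $H_A$ is the set of finite forests (finite multisets of finite rooted trees, unordered children) with nodes labeled by letters of $A$; $V_A$ is the set of contexts (forests with exactly one leaf replaced by a hole). $L\subseteq H_A$ is regular if $L=\alpha^{ -1}(X)$ for a homomorphism $\alpha$ from $A^{\Delta}$ into a finite forest algebra and some $X$ in its horizontal monoid. Definite types and local testability. All nodes have the same $0$-definite type; for $k>0$ the $k$-definite type of a node is $(a,T)$ with $a$ its label and $T$ the set of $(k-1)$-definite types of its children. For $k>0$, $s\equiv_k t$ iff the sets of $(k-1)$-definite types of the roots of $s$ and $t$ coincide and the sets of $k$-definite types of all nodes of $s$ and $t$ coincide. $L$ is $k$-locally testable if it is a union of $\equiv_k$-classes, and locally testable if it is $k$-locally testable for some $k$. -}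

module Defs where

open import Data.Nat using (ℕ; zero; suc)
open import Data.Fin using (Fin)
open import Data.Bool using (Bool; true)
open import Data.List using (List; []; _∷_; _++_; concatMap)
open import Data.List.Relation.Unary.All using (All)
open import Data.List.Relation.Unary.Any using (Any)
open import Data.Product using (Σ; ∃; _×_)
open import Data.Unit using (⊤)
open import Relation.Binary.PropositionalEquality using (_≡_)

-- Finite forest algebras (H , V), with carriers Fin nH and Fin nV.
-- Vertical product is written v ∙ w ("first v, then w"), so that the
-- right action satisfies  h (v ∙ w) = (h v) w.

record FiniteForestAlgebra : Set where
  field
    nH nV : ℕ
    _⊕_ : Fin nH → Fin nH → Fin nH
    𝟘   : Fin nH
    ⊕-assoc     : ∀ x y z → (x ⊕ y) ⊕ z ≡ x ⊕ (y ⊕ z)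
    ⊕-comm      : ∀ x y → x ⊕ y ≡ y ⊕ x
    ⊕-identityˡ : ∀ x → 𝟘 ⊕ x ≡ x
    _∙_ : Fin nV → Fin nV → Fin nV
    𝟙   : Fin nV
    ∙-assoc     : ∀ u v w → (u ∙ v) ∙ w ≡ u ∙ (v ∙ w)
    ∙-identityˡ : ∀ v → 𝟙 ∙ v ≡ v
    ∙-identityʳ : ∀ v → v ∙ 𝟙 ≡ v
    act : Fin nH → Fin nV → Fin nH
    act-identity : ∀ h → act h 𝟙 ≡ h
    act-compose  : ∀ h v w → act h (v ∙ w) ≡ act (act h v) w
    act-faithful : ∀ v w → (∀ h → act h v ≡ act h w) → v ≡ w
    insertion : ∀ v h → Σ (Fin nV) (λ u → ∀ g → act g u ≡ act g v ⊕ h)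

-- Forests over the alphabet Fin k.  Forests are represented as lists of
-- trees; order is irrelevant for everything below (≡ₖ is defined via
-- sets of types, and recognised languages are permutation invariant
-- because H is commutative).

data Tree (k : ℕ) : Set where
  node : Fin k → List (Tree k) → Tree k

Forest : ℕ → Set
Forest k = List (Tree k)

-- all nodes of a tree / forest, each represented by its subtree
-- (the definite type of a node depends only on its subtree)
mutual
  nodesT : ∀ {k} → Tree k → List (Tree k)
  nodesT (node a ts) = node a ts ∷ nodesF ts

  nodesF : ∀ {k} → Forest k → List (Tree k)
  nodesF []       = []
  nodesF (t ∷ ts) = nodesT t ++ nodesF ts

-- The homomorphism from the free forest algebra determined by the images
-- g a ∈ V of the letter contexts a□:  α(0)=0, α(s+t)=α s + α t,
-- α(a t) = α(t)·α(a□).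

module _ (F : FiniteForestAlgebra) where
  open FiniteForestAlgebra F

  mutual
    evalT : ∀ {k} → (Fin k → Fin nV) → Tree k → Fin nH
    evalT g (node a ts) = act (evalF g ts) (g a)

    evalF : ∀ {k} → (Fin k → Fin nV) → Forest k → Fin nH
    evalF g []       = 𝟘
    evalF g (t ∷ ts) = evalT g t ⊕ evalF g ts

Recognised : ∀ {k} (F : FiniteForestAlgebra) →
             (Fin k → Fin (FiniteForestAlgebra.nV F)) →
             (Fin (FiniteForestAlgebra.nH F) → Bool) → Forest k → Set
Recognised F g X s = X (evalF F g s) ≡ true

SameSet : ∀ {A : Set} → (A → A → Set) → List A → List A → Set
SameSet R xs ys = All (λ x → Any (R x) ys) xs × All (λ y → Any (λ x → R x y) xs) ys

SameType : ∀ {k} → ℕ → Tree k → Tree k → Set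
SameType zero    u v = ⊤
SameType (suc n) (node a us) (node b vs) = a ≡ b × SameSet (SameType n) us vs

Equiv : ∀ {k} → ℕ → Forest k → Forest k → Set
Equiv zero    s t = ⊤   -- not used: ≡ₖ is only defined for k > 0
Equiv (suc n) s t = SameSet (SameType n) s t
                  × SameSet (SameType (suc n)) (nodesF s) (nodesF t)

KLocallyTestable : ∀ {k} → ℕ → (Forest k → Set) → Set
KLocallyTestable m L = ∀ s t → Equiv m s t → L s → L t

LocallyTestable : ∀ {k} → (Forest k → Set) → Set
LocallyTestable L = ∃ λ n → KLocallyTestable (suc n) L

{-# OPTIONS --safe #-}
-- Let s ≈ t mean that no context separates s from t with respect to L.  Then L
-- is (n+1)-locally testable iff
--   (I)  s + s ≈ s, and
--   (E)  C[s] + D[t] ≈ C[s + t] + D[s + t] for all contexts C, D and all s, t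
--        with the same set of n-types of roots.
-- Both hold up to the (n+1)-testing congruence, hence are necessary.
-- Conversely they imply that a forest absorbs every tree whose (n+1)-types all
-- occur in it, next to any node with the same n-type as the root of that tree;
-- so two (n+1)-equivalent forests absorb each other.
--
-- Condition (E) depends on n only through the set of pairs (α s, α t) in H × H
-- with s, t as in (E).  This set decreases with n and is a function of the set
-- for n - 1, so it is constant from some computable N on, and it suffices to
-- test (E) for n = N.
module Submission where

open import Defs
open import Data.Bool using (Bool)
import Data.Bool.Properties as Bool
open import Data.Empty using (⊥)
open import Data.Fin using (Fin)
import Data.Fin.Properties as Fin
open import Data.List using (List; []; _∷_; _++_; length; filter; allFin; cartesianProduct)
open import Data.List.Properties using (filter-notAll; ++-assoc; ++-identityʳ)
open import Data.List.Membership.Propositional using (_∈_; find; lose)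
open import Data.List.Membership.Propositional.Properties
  using (∈-filter⁺; ∈-cartesianProduct⁺; ∈-allFin; ∈-∃++; ∈-++⁻; ∈-++⁺ˡ; ∈-++⁺ʳ)
open import Data.List.Relation.Binary.Pointwise using (Pointwise; []; _∷_)
import Data.List.Relation.Binary.Pointwise as Pointwise
open import Data.List.Relation.Unary.All using (all?)
import Data.List.Relation.Unary.All as All
open import Data.List.Relation.Unary.All.Properties using (¬All⇒Any¬)
open import Data.List.Relation.Unary.Any using (here; there)
open import Data.Nat using (ℕ; zero; suc; _<_)
open import Data.Nat.Induction using (<-wellFounded)
open import Data.Product using (∃; ∃₂; _×_; _,_; proj₁; proj₂; map₂)
open import Data.Sum using (_⊎_; inj₁; inj₂; [_,_])
open import Data.Unit using (⊤; tt)
open import Function using (_∘_; id; mk⇔)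
open import Induction.WellFounded using (Acc; acc)
open import Relation.Binary.Bundles using (Setoid)
open import Relation.Binary.Structures using (IsEquivalence)
open import Relation.Binary.PropositionalEquality hiding ([_]; setoid)
open import Relation.Nullary using (Dec; yes; no; ¬_)
open import Relation.Nullary.Decidable using (map′; _×-dec_; _⊎-dec_; _→-dec_; ¬?; decidable-stable)
open import Relation.Unary using (Decidable; _⊆_)

-- Chains and least fixpoints of decidable subsets of a finite set

module _ {A : Set} (elements : List A) (complete : ∀ x → x ∈ elements) where

  -- A list covering `P i` is carried along. If all its entries satisfy `P (suc i)`, the search
  -- stops at `i`; otherwise filtering by `P (suc i)` shortens the list strictly.
  descending-chain-stabilises :
    (P : ℕ → A → Set) → (∀ i → Decidable (P i)) → (∀ i → P (suc i) ⊆ P i) →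
    ∃ λ N → P N ⊆ P (suc N)
  descending-chain-stabilises P P? desc =
    go 0 elements (λ _ → complete _) (<-wellFounded _)
    where
    go : ∀ i (xs : List A) → (∀ {x} → P i x → x ∈ xs) → Acc _<_ (length xs) →
         ∃ λ N → P N ⊆ P (suc N)
    go i xs covers (acc rec) with all? (P? (suc i)) xs
    ... | yes ps = i , λ p → All.lookup ps (covers p)
    ... | no ¬ps = go (suc i) (filter (P? (suc i)) xs)
                      (λ p → ∈-filter⁺ (P? (suc i)) (covers (desc i p)) p)
                      (rec (filter-notAll (P? (suc i)) xs (¬All⇒Any¬ (P? (suc i)) xs ¬ps)))

  -- Iterating `G` from the empty set gives an ascending chain of decidable subsets of `R`. The
  -- complements descend, so they stabilise; the stable iterate is closed under `G` and hence
  -- contains `R`.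
  least-fixpoint-decidable :
    (R : A → Set) (G : (A → Set) → A → Set) →
    (∀ {P Q} → P ⊆ Q → G P ⊆ G Q) →
    (∀ {P} → Decidable P → Decidable (G P)) →
    G R ⊆ R → (∀ P → G P ⊆ P → R ⊆ P) → Decidable R
  least-fixpoint-decidable R G mono G? closed least x =
    map′ (sound N) (least (iter N) fixed) (iter? N x)
    where
    iter : ℕ → A → Set
    iter zero    _ = ⊥
    iter (suc i)   = G (iter i)

    iter? : ∀ i → Decidable (iter i)
    iter? zero    _ = no λ ()
    iter? (suc i)   = G? (iter? i)

    ascending : ∀ i → iter i ⊆ iter (suc i)
    ascending (suc i) = mono (ascending i)

    sound : ∀ i → iter i ⊆ R
    sound (suc i) = closed ∘ mono (sound i)

    stable = descending-chain-stabilises (λ i x → ¬ iter i x) (λ i → ¬? ∘ iter? i)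
               (λ i ¬p → ¬p ∘ ascending i)
    N = proj₁ stable

    fixed : iter (suc N) ⊆ iter N
    fixed p = decidable-stable (iter? N _) (λ ¬p → proj₂ stable ¬p p)

-- Definite types and sets of root types

SameType-refl : ∀ {k} n (t : Tree k) → SameType n t t
SameType-refl zero    t           = tt
SameType-refl (suc n) (node a ts) =
  refl , All.tabulate (λ x∈ → lose x∈ (SameType-refl n _))
       , All.tabulate (λ x∈ → lose x∈ (SameType-refl n _))

_≲[_]_ : ∀ {k} → Forest k → ℕ → Forest k → Set
s ≲[ n ] t = ∀ {x} → x ∈ s → ∃ λ y → y ∈ t × SameType n x y

_≃[_]_ : ∀ {k} → Forest k → ℕ → Forest k → Set
s ≃[ n ] t = SameSet (SameType n) s t

SameType-sym : ∀ {k} n {u v : Tree k} → SameType n u v → SameType n v u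
≃⇒≲ : ∀ {k} n {s t : Forest k} → s ≃[ n ] t → s ≲[ n ] t
≃⇒≳ : ∀ {k} n {s t : Forest k} → s ≃[ n ] t → t ≲[ n ] s
≲⇒≃ : ∀ {k} n {s t : Forest k} → s ≲[ n ] t → t ≲[ n ] s → s ≃[ n ] t

SameType-sym zero    _ = tt
SameType-sym (suc n) {node _ _} {node _ _} (refl , e) = refl , ≲⇒≃ n (≃⇒≳ n e) (≃⇒≲ n e)

≃⇒≲ n (f , _) x∈ = find (All.lookup f x∈)
≃⇒≳ n (_ , f) x∈ = map₂ (map₂ (SameType-sym n)) (find (All.lookup f x∈))
≲⇒≃ n f f′ = All.tabulate (λ x∈ → let _ , y∈ , e = f x∈ in lose y∈ e)
           , All.tabulate (λ x∈ → let _ , y∈ , e = f′ x∈ in lose y∈ (SameType-sym n e))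

SameType-trans : ∀ {k} n {u v w : Tree k} → SameType n u v → SameType n v w → SameType n u w
≲-trans : ∀ {k} n {s t u : Forest k} → s ≲[ n ] t → t ≲[ n ] u → s ≲[ n ] u

SameType-trans zero    _ _ = tt
SameType-trans (suc n) {node _ _} {node _ _} {node _ _} (refl , e) (refl , e′) =
  refl , ≲⇒≃ n (≲-trans n (≃⇒≲ n e) (≃⇒≲ n e′)) (≲-trans n (≃⇒≳ n e′) (≃⇒≳ n e))

≲-trans n f f′ x∈ with f x∈
... | _ , y∈ , e with f′ y∈
... | z , z∈ , e′ = z , z∈ , SameType-trans n e e′

SameType-pred : ∀ {k} n {u v : Tree k} → SameType (suc n) u v → SameType n u v
≲-pred : ∀ {k} n {s t : Forest k} → s ≲[ suc n ] t → s ≲[ n ] t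

SameType-pred zero    _ = tt
SameType-pred (suc n) {node _ _} {node _ _} (refl , e) =
  refl , ≲⇒≃ n (≲-pred n (≃⇒≲ (suc n) e)) (≲-pred n (≃⇒≳ (suc n) e))

≲-pred n f x∈ = map₂ (map₂ (SameType-pred n)) (f x∈)

module _ {k : ℕ} (n : ℕ) where

  ⊆⇒≲ : {s t : Forest k} → (∀ {x} → x ∈ s → x ∈ t) → s ≲[ n ] t
  ⊆⇒≲ s⊆t x∈ = _ , s⊆t x∈ , SameType-refl n _

  ≲-refl : {s : Forest k} → s ≲[ n ] s
  ≲-refl = ⊆⇒≲ id

  ≲-++ : {s t u : Forest k} → s ≲[ n ] u → t ≲[ n ] u → (s ++ t) ≲[ n ] u
  ≲-++ {s} f f′ = [ f , f′ ] ∘ ∈-++⁻ s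

  ≲-++ˡ : {s t u : Forest k} → s ≲[ n ] t → s ≲[ n ] (t ++ u)
  ≲-++ˡ f x∈ = map₂ (λ (y∈ , e) → ∈-++⁺ˡ y∈ , e) (f x∈)

  ≲-++ʳ : {s t u : Forest k} → s ≲[ n ] u → s ≲[ n ] (t ++ u)
  ≲-++ʳ {t = t} f x∈ = map₂ (λ (y∈ , e) → ∈-++⁺ʳ t y∈ , e) (f x∈)

  ≲-singleton : {u v : Tree k} → SameType n u v → (u ∷ []) ≲[ n ] (v ∷ [])
  ≲-singleton e (here refl) = _ , here refl , e

  ≃-refl : {s : Forest k} → s ≃[ n ] s
  ≃-refl = ≲⇒≃ n ≲-refl ≲-refl

  ≃-sym : {s t : Forest k} → s ≃[ n ] t → t ≃[ n ] s
  ≃-sym e = ≲⇒≃ n (≃⇒≳ n e) (≃⇒≲ n e)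

  ≃-trans : {s t u : Forest k} → s ≃[ n ] t → t ≃[ n ] u → s ≃[ n ] u
  ≃-trans e e′ = ≲⇒≃ n (≲-trans n (≃⇒≲ n e) (≃⇒≲ n e′)) (≲-trans n (≃⇒≳ n e′) (≃⇒≳ n e))

  ≃-++ : {s s′ t t′ : Forest k} → s ≃[ n ] s′ → t ≃[ n ] t′ → (s ++ t) ≃[ n ] (s′ ++ t′)
  ≃-++ {s} {s′} {t} {t′} e e′ =
    ≲⇒≃ n (≲-++ {s} (≲-++ˡ (≃⇒≲ n e)) (≲-++ʳ {t = s′} (≃⇒≲ n e′)))
          (≲-++ {s′} (≲-++ˡ (≃⇒≳ n e)) (≲-++ʳ {t = s} (≃⇒≳ n e′)))

  ≲⇒≃-++ : {s t : Forest k} → s ≲[ n ] t → (s ++ t) ≃[ n ] t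
  ≲⇒≃-++ {s} f = ≲⇒≃ n (≲-++ {s} f ≲-refl) (≲-++ʳ {t = s} ≲-refl)

  ≃-singleton : {u v : Tree k} → SameType n u v → (u ∷ []) ≃[ n ] (v ∷ [])
  ≃-singleton e = ≲⇒≃ n (≲-singleton e) (≲-singleton (SameType-sym n e))

-- Equal shapes down to depth n, child by child.  Up to idempotence this is the
-- same as having equal n-types, but it is generated by adding one pair of
-- trees at a time.
Aligned : ∀ {k} → ℕ → Tree k → Tree k → Set
Aligned zero    _           _           = ⊤
Aligned (suc n) (node a us) (node b vs) = a ≡ b × Pointwise (Aligned n) us vs

Aligned-sym : ∀ {k} n {u v : Tree k} → Aligned n u v → Aligned n v u
Aligned-sym zero    _ = tt
Aligned-sym (suc n) {node _ _} {node _ _} (e , ps) = sym e , Pointwise.symmetric (Aligned-sym n) ps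

Aligned⇒≃ : ∀ {k} n {s t : Forest k} → Pointwise (Aligned n) s t → s ≃[ n ] t
Aligned⇒SameType : ∀ {k} n {u v : Tree k} → Aligned n u v → SameType n u v

Aligned⇒≃ n []       = ≃-refl n
Aligned⇒≃ n (p ∷ ps) = ≃-++ n (≃-singleton n (Aligned⇒SameType n p)) (Aligned⇒≃ n ps)

Aligned⇒SameType zero    _ = tt
Aligned⇒SameType (suc n) {node _ _} {node _ _} (e , ps) = e , Aligned⇒≃ n ps

-- Contexts, and the laws that hold up to (n+1)-testing

nodesF-++ : ∀ {k} (s t : Forest k) → nodesF (s ++ t) ≡ nodesF s ++ nodesF t
nodesF-++ []      t = refl
nodesF-++ (x ∷ s) t = trans (cong (nodesT x ++_) (nodesF-++ s t)) (sym (++-assoc (nodesT x) _ _))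

-- Contexts from the hole outwards, up to reordering of siblings.
data Ctx (k : ℕ) : Set where
  □    : Ctx k
  _▹_  : Ctx k → Fin k → Ctx k
  _⊹_  : Ctx k → Forest k → Ctx k

plug : ∀ {k} → Ctx k → Forest k → Forest k
plug □       s = s
plug (C ▹ a) s = node a (plug C s) ∷ []
plug (C ⊹ r) s = plug C s ++ r

_⊚_ : ∀ {k} → Ctx k → Ctx k → Ctx k
□       ⊚ D = D
(C ▹ a) ⊚ D = (C ⊚ D) ▹ a
(C ⊹ r) ⊚ D = (C ⊚ D) ⊹ r

plug-⊚ : ∀ {k} (C D : Ctx k) s → plug (C ⊚ D) s ≡ plug C (plug D s)
plug-⊚ □       D s = refl
plug-⊚ (C ▹ a) D s = cong (λ u → node a u ∷ []) (plug-⊚ C D s)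
plug-⊚ (C ⊹ r) D s = cong (_++ r) (plug-⊚ C D s)

module _ {k : ℕ} (n : ℕ) where

  plug-≃ : (C : Ctx k) {s t : Forest k} → s ≃[ n ] t → plug C s ≃[ n ] plug C t
  plug-≃ □       e = e
  plug-≃ (C ▹ a) e = ≃-singleton n (SameType-pred n (refl , plug-≃ C e))
  plug-≃ (C ⊹ r) e = ≃-++ n (plug-≃ C e) (≃-refl n)

  nodesF-plug : (C : Ctx k) {s : Forest k} → ∀ {x} → x ∈ nodesF s → x ∈ nodesF (plug C s)
  nodesF-plug □       x∈ = x∈
  nodesF-plug (C ▹ a) x∈ = there (∈-++⁺ˡ (nodesF-plug C x∈))
  nodesF-plug (C ⊹ r) {s} x∈ =
    subst (_ ∈_) (sym (nodesF-++ (plug C s) r)) (∈-++⁺ˡ (nodesF-plug C x∈))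

  -- Each node of `plug C s` outside `s` has a counterpart in `plug C t` with the same (n+1)-type,
  -- because equality of root n-types propagates along the path above the hole. So it is enough to
  -- cover `s` and `plug C t`.
  nodesF-plug-≲ : (C : Ctx k) {s t : Forest k} {ws : List (Tree k)} → s ≃[ n ] t →
                  nodesF s ≲[ suc n ] ws →
                  nodesF (plug C t) ≲[ suc n ] ws →
                  nodesF (plug C s) ≲[ suc n ] ws
  nodesF-plug-≲ □ e f f′ = f
  nodesF-plug-≲ (C ▹ a) e f f′ (here refl) with f′ (here refl)
  ... | y , y∈ , e′ = y , y∈ , SameType-trans (suc n) (refl , plug-≃ C e) e′
  nodesF-plug-≲ (C ▹ a) {s} e f f′ (there x∈) =
    nodesF-plug-≲ C e f (λ y∈ → f′ (there (∈-++⁺ˡ y∈)))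
      (subst (_ ∈_) (++-identityʳ (nodesF (plug C s))) x∈)
  nodesF-plug-≲ (C ⊹ r) {s} {t} e f f′ rewrite nodesF-++ (plug C s) r | nodesF-++ (plug C t) r =
    ≲-++ (suc n) {nodesF (plug C s)}
      (nodesF-plug-≲ C e f (f′ ∘ ∈-++⁺ˡ)) (f′ ∘ ∈-++⁺ʳ (nodesF (plug C t)))

  Equiv-plug : (C : Ctx k) {s t : Forest k} → Equiv (suc n) s t → Equiv (suc n) (plug C s) (plug C t)
  Equiv-plug C {s} {t} (roots , nodes) =
    plug-≃ C roots ,
    ≲⇒≃ (suc n)
      (nodesF-plug-≲ C roots (≲-trans (suc n) (≃⇒≲ (suc n) nodes) (⊆⇒≲ (suc n) (nodesF-plug C)))
                     (≲-refl (suc n)))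
      (nodesF-plug-≲ C (≃-sym n roots)
                     (≲-trans (suc n) (≃⇒≳ (suc n) nodes) (⊆⇒≲ (suc n) (nodesF-plug C)))
                     (≲-refl (suc n)))

  Equiv-idem : (s : Forest k) → Equiv (suc n) (s ++ s) s
  Equiv-idem s rewrite nodesF-++ s s = ≲⇒≃-++ n (≲-refl n) , ≲⇒≃-++ (suc n) (≲-refl (suc n))

  -- `s`, `t` and `s ++ t` have the same root n-types, so putting one for another into a hole
  -- changes no (n+1)-type on the context. The nodes of `s` and of `t` occur on both sides.
  Equiv-exchange : (C D : Ctx k) {s t : Forest k} → s ≃[ n ] t →
                   Equiv (suc n) (plug C s ++ plug D t) (plug C (s ++ t) ++ plug D (s ++ t))
  Equiv-exchange C D {s} {t} e =
    ≃-++ n (plug-≃ C es) (plug-≃ D et) ,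
    subst₂ (SameSet (SameType (suc n)))
      (sym (nodesF-++ (plug C s) (plug D t))) (sym (nodesF-++ (plug C st) (plug D st)))
      (≲⇒≃ (suc n)
        (≲-++ (suc n) {nodesF (plug C s)}
          (nodesF-plug-≲ C es (⊆ʳ s λ x∈ → ∈-++⁺ˡ (nodesF-plug C (inˡ x∈))) (⊆ʳ (plug C st) ∈-++⁺ˡ))
          (nodesF-plug-≲ D et (⊆ʳ t λ x∈ → ∈-++⁺ˡ (nodesF-plug C (inʳ x∈)))
                              (⊆ʳ (plug D st) (∈-++⁺ʳ (nodesF (plug C st))))))
        (≲-++ (suc n) {nodesF (plug C st)}
          (nodesF-plug-≲ C (≃-sym n es) both (⊆ʳ (plug C s) ∈-++⁺ˡ))
          (nodesF-plug-≲ D (≃-sym n et) both (⊆ʳ (plug D t) (∈-++⁺ʳ (nodesF (plug C s)))))))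
    where
    st = s ++ t
    es : s ≃[ n ] st
    es = ≲⇒≃ n (≲-++ˡ n (≲-refl n)) (≲-++ n {s} (≲-refl n) (≃⇒≳ n e))
    et : t ≃[ n ] st
    et = ≃-sym n (≲⇒≃-++ n (≃⇒≲ n e))
    ⊆ʳ : ∀ u {ws} → (∀ {x} → x ∈ nodesF u → x ∈ ws) → nodesF u ≲[ suc n ] ws
    ⊆ʳ u = ⊆⇒≲ (suc n)
    inˡ : ∀ {x} → x ∈ nodesF s → x ∈ nodesF st
    inˡ x∈ = subst (_ ∈_) (sym (nodesF-++ s t)) (∈-++⁺ˡ x∈)
    inʳ : ∀ {x} → x ∈ nodesF t → x ∈ nodesF st
    inʳ x∈ = subst (_ ∈_) (sym (nodesF-++ s t)) (∈-++⁺ʳ (nodesF s) x∈)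
    both : nodesF st ≲[ suc n ] (nodesF (plug C s) ++ nodesF (plug D t))
    both rewrite nodesF-++ s t =
      ≲-++ (suc n) {nodesF s} (⊆ʳ s λ x∈ → ∈-++⁺ˡ (nodesF-plug C x∈))
                              (⊆ʳ t λ x∈ → ∈-++⁺ʳ (nodesF (plug C s)) (nodesF-plug D x∈))

-- Congruences with commuting siblings, and the effect of idempotence

module Congruence {k : ℕ} (_≈_ : Forest k → Forest k → Set) (isEquivalence : IsEquivalence _≈_)
  (plug-cong : ∀ C {s t} → s ≈ t → plug C s ≈ plug C t)
  (++-comm : ∀ s t → (s ++ t) ≈ (t ++ s))
  where

  setoid : Setoid _ _
  setoid = record { isEquivalence = isEquivalence }

  open IsEquivalence isEquivalence renaming (refl to ≈-refl; sym to ≈-sym; trans to ≈-trans)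
  open import Relation.Binary.Reasoning.Setoid setoid

  ++-cong : ∀ {s s′ t t′} → s ≈ s′ → t ≈ t′ → (s ++ t) ≈ (s′ ++ t′)
  ++-cong {s} {s′} {t} {t′} e e′ = begin
    s ++ t   ≈⟨ plug-cong (□ ⊹ t) e ⟩
    s′ ++ t  ≈⟨ ++-comm s′ t ⟩
    t ++ s′  ≈⟨ plug-cong (□ ⊹ s′) e′ ⟩
    t′ ++ s′ ≈⟨ ++-comm t′ s′ ⟩
    s′ ++ t′ ∎

  ∈⇒≈∷ : ∀ {y s} → y ∈ s → ∃ λ r → s ≈ (y ∷ r)
  ∈⇒≈∷ {y} y∈ with ∈-∃++ y∈
  ... | l , r , refl = r ++ l , ++-comm l (y ∷ r)

  -- `⊹` adds siblings only to the right of the hole, so those on the left are moved there by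
  -- commutativity. Splitting a forest at a node is therefore possible only up to `≈`.
  nodesT⇒plug : ∀ t {y} → y ∈ nodesT t → ∃ λ C → (t ∷ []) ≈ plug C (y ∷ [])
  nodesF⇒plug : ∀ s {y} → y ∈ nodesF s → ∃ λ C → s ≈ plug C (y ∷ [])

  nodesT⇒plug (node a ts) (here refl) = □ , ≈-refl
  nodesT⇒plug (node a ts) (there y∈) with nodesF⇒plug ts y∈
  ... | C , e = C ▹ a , plug-cong (□ ▹ a) e

  nodesF⇒plug (t ∷ ts) y∈ with ∈-++⁻ (nodesT t) y∈
  ... | inj₁ y∈t with nodesT⇒plug t y∈t
  ...   | C , e = C ⊹ ts , plug-cong (□ ⊹ ts) e
  nodesF⇒plug (t ∷ ts) y∈ | inj₂ y∈ts with nodesF⇒plug ts y∈ts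
  ...   | C , e = C ⊹ (t ∷ []) , ≈-trans (++-comm (t ∷ []) ts) (plug-cong (□ ⊹ (t ∷ [])) e)

  module Idempotent (idem : ∀ s → (s ++ s) ≈ s) where

    ++-absorb : ∀ s t → (s ++ (s ++ t)) ≈ (s ++ t)
    ++-absorb s t = begin
      s ++ (s ++ t) ≡⟨ ++-assoc s s t ⟨
      (s ++ s) ++ t ≈⟨ plug-cong (□ ⊹ t) (idem s) ⟩
      s ++ t        ∎

    ∈-absorb : ∀ {y s} → y ∈ s → (y ∷ s) ≈ s
    ∈-absorb {y} {s} y∈ with ∈⇒≈∷ y∈
    ... | r , e = begin
      y ∷ s     ≈⟨ ++-cong {y ∷ []} ≈-refl e ⟩
      y ∷ y ∷ r ≈⟨ ++-absorb (y ∷ []) r ⟩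
      y ∷ r     ≈⟨ e ⟨
      s         ∎

    -- Idempotence allows roots to be duplicated. `align-half` pairs every root of `s` with a root
    -- of `t` of the same n-type, and `t` absorbs the chosen partners. Doing this in both directions
    -- and concatenating gives aligned forests.
    align-tree : ∀ n {u v} → SameType n u v →
                 ∃₂ λ u′ v′ → Aligned n u′ v′ × (u ∷ []) ≈ (u′ ∷ []) × (v ∷ []) ≈ (v′ ∷ [])
    align-half : ∀ n {t} s → s ≲[ n ] t →
                 ∃₂ λ s′ t′ → Pointwise (Aligned n) s′ t′ × s ≈ s′ × (t′ ++ t) ≈ t
    align-forest : ∀ n {s t} → s ≃[ n ] t →
                   ∃₂ λ s′ t′ → Pointwise (Aligned n) s′ t′ × s ≈ s′ × t ≈ t′

    align-tree zero    {u} {v} _ = u , v , tt , ≈-refl , ≈-refl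
    align-tree (suc n) {node a _} {node .a _} (refl , us≃vs) with align-forest n us≃vs
    ... | us′ , vs′ , ps , e , e′ =
      node a us′ , node a vs′ , (refl , ps) , plug-cong (□ ▹ a) e , plug-cong (□ ▹ a) e′

    align-half n []       _ = [] , [] , [] , ≈-refl , ≈-refl
    align-half n {t} (x ∷ s) f with f (here refl) | align-half n s (λ x∈ → f (there x∈))
    ... | y , y∈ , x~y | s′ , t′ , ps , s≈s′ , t′t≈t with align-tree n x~y
    ...   | x′ , y′ , p , e , e′ = x′ ∷ s′ , y′ ∷ t′ , p ∷ ps , ++-cong e s≈s′ , (begin
      y′ ∷ (t′ ++ t) ≈⟨ ++-cong (≈-sym e′) t′t≈t ⟩
      y ∷ t          ≈⟨ ∈-absorb y∈ ⟩
      t              ∎)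

    align-forest n {s} {t} s≃t
      with align-half n s (≃⇒≲ n s≃t) | align-half n t (≃⇒≳ n s≃t)
    ... | s₁ , t₁ , ps , s≈s₁ , t₁t≈t | t₂ , s₂ , qs , t≈t₂ , s₂s≈s =
      s₂ ++ s₁ , t₂ ++ t₁ ,
      Pointwise.++⁺ (Pointwise.symmetric (Aligned-sym n) qs) ps ,
      ≈-trans (≈-sym s₂s≈s) (++-cong {s₂} ≈-refl s≈s₁) ,
      ≈-trans (≈-sym t₁t≈t) (≈-trans (++-comm t₁ _) (++-cong t≈t₂ ≈-refl))

    -- Absorption under the exchange law

    module Exchange (n : ℕ)
      (exchange : ∀ C D {s t} → s ≃[ n ] t →
                  (plug C s ++ plug D t) ≈ (plug C (s ++ t) ++ plug D (s ++ t)))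
      where

      -- `s` and `s ++ t` have the same root n-types, so exchange with `C` in both places turns each
      -- summand into `plug C (s ++ (s ++ t))`, and idempotence merges the two.
      plug-mono : ∀ C {s t} → s ≃[ n ] t → (plug C s ++ plug C (s ++ t)) ≈ plug C (s ++ t)
      plug-mono C {s} {t} e = begin
        plug C s ++ plug C (s ++ t)                           ≈⟨ exchange C C (≃-trans n e (≃-sym n (≲⇒≃-++ n (≃⇒≲ n e)))) ⟩
        plug C (s ++ (s ++ t)) ++ plug C (s ++ (s ++ t))      ≈⟨ idem _ ⟩
        plug C (s ++ (s ++ t))                                ≈⟨ plug-cong C (++-absorb s t) ⟩
        plug C (s ++ t)                                       ∎

      module _ {s : Forest k} where

        -- A tree all of whose (n+1)-types occur in s can be added next to any
        -- node y of s of the same n-type.  A node of s with the (n+1)-type of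
        -- t first absorbs the children of t, after which t itself is absorbed
        -- next to that node; the exchange law moves t from there to y.
        absorb-tree : ∀ t → nodesT t ≲[ suc n ] nodesF s →
                      ∀ C {y} → s ≈ plug C (y ∷ []) → SameType n y t →
                      plug C (y ∷ t ∷ []) ≈ s

        -- The first tree `t` is absorbed next to a root of `u` of the same n-type, and the
        -- remaining `ts` by induction. Thus `plug C (t ∷ u)` and `plug C (ts ++ u)` both equal `s`
        -- up to `≈`; their holes carry the same root n-types, so exchange joins them.
        absorb-forest : ∀ ts → nodesF ts ≲[ suc n ] nodesF s →
                        ∀ C {u} → s ≈ plug C u → ts ≲[ n ] u →
                        plug C (ts ++ u) ≈ s

        absorb-tree (node a ts) covered C {y} s≈Cy y~t with covered (here refl)
        ... | node .a u , z∈ , refl , ts≃u with nodesF⇒plug s z∈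
        ...   | D , s≈Dz = ≈-sym (begin
          s                                         ≈⟨ idem s ⟨
          s ++ s                                    ≈⟨ ++-cong s≈Cy s≈DZ ⟩
          plug C (y ∷ []) ++ plug D (Z ∷ [])        ≈⟨ exchange C D (≃-singleton n y~Z) ⟩
          plug C (y ∷ Z ∷ []) ++ plug D (y ∷ Z ∷ []) ≈⟨ ++-cong (plug-cong C yZ≈ytZ) (plug-cong D yZ≈ytZ) ⟩
          -- Exchange is read from right to left: `C` keeps `y` and `t`, and `D` keeps only `Z`.
          plug C (y ∷ t ∷ Z ∷ []) ++ plug D (y ∷ t ∷ Z ∷ []) ≈⟨ exchange C D yt≃Z ⟨
          plug C (y ∷ t ∷ []) ++ plug D (Z ∷ [])    ≈⟨ ++-cong ≈-refl (≈-trans (≈-sym s≈DZ) s≈Cy) ⟩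
          plug C (y ∷ t ∷ []) ++ plug C (y ∷ [])    ≈⟨ ++-comm (plug C (y ∷ t ∷ [])) _ ⟩
          plug C (y ∷ []) ++ plug C (y ∷ t ∷ [])    ≈⟨ plug-mono C (≃-singleton n y~t) ⟩
          plug C (y ∷ t ∷ [])                       ∎)
          where
          t = node a ts
          Z = node a (ts ++ u)
          s≈DZ : s ≈ plug D (Z ∷ [])
          s≈DZ = ≈-sym (subst (_≈ s) (plug-⊚ D (□ ▹ a) (ts ++ u))
                   (absorb-forest ts (λ x∈ → covered (there x∈)) (D ⊚ (□ ▹ a))
                     (subst (s ≈_) (sym (plug-⊚ D (□ ▹ a) u)) s≈Dz) (≃⇒≲ n ts≃u)))
          t~Z : SameType n t Z
          t~Z = SameType-pred n (refl , ≃-trans n ts≃u (≃-sym n (≲⇒≃-++ n (≃⇒≲ n ts≃u))))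
          y~Z : SameType n y Z
          y~Z = SameType-trans n y~t t~Z
          -- `Z` is `t` with further children `u` whose n-types `t` already has below its root, so
          -- `plug-mono` at the one-letter context lets `Z` absorb `t`.
          yZ≈ytZ : (y ∷ Z ∷ []) ≈ (y ∷ t ∷ Z ∷ [])
          yZ≈ytZ = ++-cong {y ∷ []} ≈-refl (≈-sym (plug-mono (□ ▹ a) ts≃u))
          yt≃Z : (y ∷ t ∷ []) ≃[ n ] (Z ∷ [])
          yt≃Z = ≃-trans n (≲⇒≃-++ n (≲-singleton n y~t)) (≃-singleton n t~Z)

        absorb-forest []       _       C s≈Cu _    = ≈-sym s≈Cu
        absorb-forest (t ∷ ts) covered C {u} s≈Cu ts≲u with ts≲u (here refl)
        ... | y , y∈ , t~y with ∈⇒≈∷ y∈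
        ...   | r , u≈yr = begin
          plug C (t ∷ (ts ++ u))                                       ≈⟨ idem _ ⟨
          plug C (t ∷ (ts ++ u)) ++ plug C (t ∷ (ts ++ u))             ≈⟨ ++-cong (plug-cong C merge) (plug-cong C merge) ⟨
          plug C ((t ∷ u) ++ (ts ++ u)) ++ plug C ((t ∷ u) ++ (ts ++ u)) ≈⟨ exchange C C tu≃tsu ⟨
          plug C (t ∷ u) ++ plug C (ts ++ u)                           ≈⟨ ++-cong Ctu≈s Ctsu≈s ⟩
          s ++ s                                                       ≈⟨ idem s ⟩
          s                                                            ∎
          where
          C′ = C ⊚ (□ ⊹ r)
          Ctu≈s : plug C (t ∷ u) ≈ s
          Ctu≈s = begin
            plug C (t ∷ u)          ≈⟨ plug-cong C (++-cong {t ∷ []} ≈-refl u≈yr) ⟩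
            plug C (t ∷ y ∷ r)      ≈⟨ plug-cong C (plug-cong (□ ⊹ r) (++-comm (t ∷ []) (y ∷ []))) ⟩
            plug C (y ∷ t ∷ r)      ≡⟨ plug-⊚ C (□ ⊹ r) (y ∷ t ∷ []) ⟨
            plug C′ (y ∷ t ∷ [])    ≈⟨ absorb-tree t (λ x∈ → covered (∈-++⁺ˡ x∈)) C′
                                         (subst (s ≈_) (sym (plug-⊚ C (□ ⊹ r) (y ∷ [])))
                                           (≈-trans s≈Cu (plug-cong C u≈yr)))
                                         (SameType-sym n t~y) ⟩
            s                       ∎
          Ctsu≈s : plug C (ts ++ u) ≈ s
          Ctsu≈s = absorb-forest ts (λ x∈ → covered (∈-++⁺ʳ (nodesT t) x∈)) C s≈Cu
                     (λ x∈ → ts≲u (there x∈))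
          merge : ((t ∷ u) ++ (ts ++ u)) ≈ (t ∷ (ts ++ u))
          merge = ++-cong {t ∷ []} ≈-refl (begin
            u ++ (ts ++ u) ≈⟨ ++-cong {u} ≈-refl (++-comm ts u) ⟩
            u ++ (u ++ ts) ≈⟨ ++-absorb u ts ⟩
            u ++ ts        ≈⟨ ++-comm u ts ⟩
            ts ++ u        ∎)
          tu≃tsu : (t ∷ u) ≃[ n ] (ts ++ u)
          tu≃tsu = ≃-trans n (≲⇒≃-++ n {t ∷ []} λ { (here refl) → y , y∈ , t~y })
                             (≃-sym n (≲⇒≃-++ n (λ x∈ → ts≲u (there x∈))))

      Equiv⇒≈ : ∀ {s t} → Equiv (suc n) s t → s ≈ t
      Equiv⇒≈ {s} {t} (roots , nodes) = begin
        s      ≈⟨ absorb-forest t (≃⇒≳ (suc n) nodes) □ ≈-refl (≃⇒≳ n roots) ⟨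
        t ++ s ≈⟨ ++-comm t s ⟩
        s ++ t ≈⟨ absorb-forest s (≃⇒≲ (suc n) nodes) □ ≈-refl (≃⇒≲ n roots) ⟩
        t      ∎

-- Values in the algebra and the syntactic congruence of the language

module Recognition {k : ℕ} (F : FiniteForestAlgebra) (g : Fin k → Fin (FiniteForestAlgebra.nV F))
  (X : Fin (FiniteForestAlgebra.nH F) → Bool) where

  open FiniteForestAlgebra F

  ⟦_⟧ : Forest k → Fin nH
  ⟦_⟧ = evalF F g

  ⟦_⟧ᵗ : Tree k → Fin nH
  ⟦_⟧ᵗ = evalT F g

  ins : Fin nV → Fin nH → Fin nV
  ins v h = proj₁ (insertion v h)

  ⊕-identityʳ : ∀ x → x ⊕ 𝟘 ≡ x
  ⊕-identityʳ x = trans (⊕-comm x 𝟘) (⊕-identityˡ x)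

  ⟦⟧-++ : ∀ s t → ⟦ s ++ t ⟧ ≡ ⟦ s ⟧ ⊕ ⟦ t ⟧
  ⟦⟧-++ []      t = sym (⊕-identityˡ _)
  ⟦⟧-++ (x ∷ s) t = trans (cong (⟦ x ⟧ᵗ ⊕_) (⟦⟧-++ s t)) (sym (⊕-assoc _ _ _))

  val : Ctx k → Fin nV
  val □       = 𝟙
  val (C ▹ a) = val C ∙ g a
  val (C ⊹ r) = ins (val C) ⟦ r ⟧

  ⟦⟧-plug : ∀ C s → ⟦ plug C s ⟧ ≡ act ⟦ s ⟧ (val C)
  ⟦⟧-plug □       s = sym (act-identity _)
  ⟦⟧-plug (C ▹ a) s = begin
    act ⟦ plug C s ⟧ (g a) ⊕ 𝟘      ≡⟨ ⊕-identityʳ _ ⟩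
    act ⟦ plug C s ⟧ (g a)          ≡⟨ cong (λ h → act h (g a)) (⟦⟧-plug C s) ⟩
    act (act ⟦ s ⟧ (val C)) (g a)   ≡⟨ act-compose _ _ _ ⟨
    act ⟦ s ⟧ (val C ∙ g a)         ∎
    where open ≡-Reasoning
  ⟦⟧-plug (C ⊹ r) s = begin
    ⟦ plug C s ++ r ⟧               ≡⟨ ⟦⟧-++ (plug C s) r ⟩
    ⟦ plug C s ⟧ ⊕ ⟦ r ⟧            ≡⟨ cong (_⊕ ⟦ r ⟧) (⟦⟧-plug C s) ⟩
    act ⟦ s ⟧ (val C) ⊕ ⟦ r ⟧       ≡⟨ proj₂ (insertion (val C) ⟦ r ⟧) ⟦ s ⟧ ⟨
    act ⟦ s ⟧ (val (C ⊹ r))         ∎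
    where open ≡-Reasoning

  -- A record rather than a function type, so that s and t can be inferred.
  record _≈_ (s t : Forest k) : Set where
    constructor mk≈
    field indistinguishable : ∀ O → X ⟦ plug O s ⟧ ≡ X ⟦ plug O t ⟧
  open _≈_

  ≈-isEquivalence : IsEquivalence _≈_
  ≈-isEquivalence = record
    { refl  = mk≈ λ _ → refl
    ; sym   = λ e → mk≈ λ O → sym (indistinguishable e O)
    ; trans = λ e e′ → mk≈ λ O → trans (indistinguishable e O) (indistinguishable e′ O)
    }

  ≈-plug : ∀ C {s t} → s ≈ t → plug C s ≈ plug C t
  ≈-plug C {s} {t} e = mk≈ λ O →
    subst₂ (λ u v → X ⟦ u ⟧ ≡ X ⟦ v ⟧) (plug-⊚ O C s) (plug-⊚ O C t) (indistinguishable e (O ⊚ C))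

  -- Contexts act through their values in `V`, so separation depends only on the values of the two
  -- forests and on the finitely many context values. This is what makes (I) and (E) finite
  -- statements.
  ≡⇒≈ : ∀ {s t} → (∀ O → X (act ⟦ s ⟧ (val O)) ≡ X (act ⟦ t ⟧ (val O))) → s ≈ t
  ≡⇒≈ {s} {t} e = mk≈ λ O →
    trans (cong X (⟦⟧-plug O s)) (trans (e O) (cong X (sym (⟦⟧-plug O t))))

  ≈⇒≡ : ∀ {s t} → s ≈ t → ∀ O → X (act ⟦ s ⟧ (val O)) ≡ X (act ⟦ t ⟧ (val O))
  ≈⇒≡ {s} {t} e O =
    trans (cong X (sym (⟦⟧-plug O s))) (trans (indistinguishable e O) (cong X (⟦⟧-plug O t)))

  ≈-comm : ∀ s t → (s ++ t) ≈ (t ++ s)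
  ≈-comm s t = ≡⇒≈ λ O → cong (λ h → X (act h (val O)))
    (trans (⟦⟧-++ s t) (trans (⊕-comm _ _) (sym (⟦⟧-++ t s))))

  open Congruence _≈_ ≈-isEquivalence ≈-plug ≈-comm

  -- Deciding which values forests, trees and contexts take

  IsForestValue : Fin nH → Set
  IsForestValue h = ∃ λ s → ⟦ s ⟧ ≡ h

  IsTreeValue : Fin nH → Set
  IsTreeValue h = ∃ λ t → ⟦ t ⟧ᵗ ≡ h

  IsContextValue : Fin nV → Set
  IsContextValue v = ∃ λ C → val C ≡ v

  isForestValue? : Decidable IsForestValue
  isForestValue? = least-fixpoint-decidable (allFin nH) ∈-allFin IsForestValue Step
    (λ P⊆Q → [ inj₁ , (λ (a , x , y , p , q , e) → inj₂ (a , x , y , P⊆Q p , P⊆Q q , e)) ])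
    (λ P? h → (𝟘 Fin.≟ h) ⊎-dec
      Fin.any? λ a → Fin.any? λ x → Fin.any? λ y → P? x ×-dec P? y ×-dec (act x (g a) ⊕ y Fin.≟ h))
    (λ { (inj₁ refl) → [] , refl
       ; (inj₂ (a , _ , _ , (s , refl) , (t , refl) , refl)) → node a s ∷ t , refl })
    (λ { P closed (s , refl) → least P closed s })
    where
    Step : (Fin nH → Set) → Fin nH → Set
    Step P h = 𝟘 ≡ h ⊎ ∃ λ a → ∃ λ x → ∃ λ y → P x × P y × act x (g a) ⊕ y ≡ h

    least : ∀ P → Step P ⊆ P → ∀ s → P ⟦ s ⟧
    least P closed []              = closed (inj₁ refl)
    least P closed (node a ts ∷ s) =
      closed (inj₂ (a , _ , _ , least P closed ts , least P closed s , refl))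

  isTreeValue? : Decidable IsTreeValue
  isTreeValue? x = map′
    (λ { (a , _ , (s , refl) , refl) → node a s , refl })
    (λ { (node a s , refl) → a , _ , (s , refl) , refl })
    (Fin.any? λ a → Fin.any? λ h → isForestValue? h ×-dec (act h (g a) Fin.≟ x))

  isContextValue? : Decidable IsContextValue
  isContextValue? = least-fixpoint-decidable (allFin nV) ∈-allFin IsContextValue Step
    (λ P⊆Q → [ inj₁ , inj₂ ∘ [ (λ (a , w , p , e) → inj₁ (a , w , P⊆Q p , e))
                             , (λ (h , w , r , p , e) → inj₂ (h , w , r , P⊆Q p , e)) ] ])
    (λ P? v → (𝟙 Fin.≟ v)
      ⊎-dec (Fin.any? λ a → Fin.any? λ w → P? w ×-dec (w ∙ g a Fin.≟ v))
      ⊎-dec (Fin.any? λ h → Fin.any? λ w → isForestValue? h ×-dec P? w ×-dec (ins w h Fin.≟ v)))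
    (λ { (inj₁ refl) → □ , refl
       ; (inj₂ (inj₁ (a , _ , (C , refl) , refl))) → C ▹ a , refl
       ; (inj₂ (inj₂ (_ , _ , (s , refl) , (C , refl) , refl))) → C ⊹ s , refl })
    (λ { P closed (C , refl) → least P closed C })
    where
    Step : (Fin nV → Set) → Fin nV → Set
    Step P v = 𝟙 ≡ v
             ⊎ (∃ λ a → ∃ λ w → P w × w ∙ g a ≡ v)
             ⊎ (∃ λ h → ∃ λ w → IsForestValue h × P w × ins w h ≡ v)

    least : ∀ P → Step P ⊆ P → ∀ C → P (val C)
    least P closed □       = closed (inj₁ refl)
    least P closed (C ▹ a) = closed (inj₂ (inj₁ (a , _ , least P closed C , refl)))
    least P closed (C ⊹ r) =
      closed (inj₂ (inj₂ (_ , _ , (r , refl) , least P closed C , refl)))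

  -- Values of aligned pairs, and their stabilisation

  TreePair : ℕ → Fin nH × Fin nH → Set
  TreePair n (x , y) = ∃₂ λ u v → Aligned n u v × ⟦ u ⟧ᵗ ≡ x × ⟦ v ⟧ᵗ ≡ y

  ForestPair : ℕ → Fin nH × Fin nH → Set
  ForestPair n (x , y) = ∃₂ λ s t → Pointwise (Aligned n) s t × ⟦ s ⟧ ≡ x × ⟦ t ⟧ ≡ y

  pairs : List (Fin nH × Fin nH)
  pairs = cartesianProduct (allFin nH) (allFin nH)

  ∈-pairs : ∀ p → p ∈ pairs
  ∈-pairs (x , y) = ∈-cartesianProduct⁺ (∈-allFin x) (∈-allFin y)

  -- `ForestPair n` is the submonoid of H × H generated by `TreePair n`.
  forestPair?-from : ∀ n → Decidable (TreePair n) → Decidable (ForestPair n)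
  forestPair?-from n treePair? = least-fixpoint-decidable pairs ∈-pairs (ForestPair n) Step
    (λ P⊆Q → [ inj₁ , (λ (x , y , x′ , y′ , p , q , e) → inj₂ (x , y , x′ , y′ , p , P⊆Q q , e)) ])
    (λ P? (h , h′) → ((𝟘 Fin.≟ h) ×-dec (𝟘 Fin.≟ h′)) ⊎-dec
      Fin.any? λ x → Fin.any? λ y → Fin.any? λ x′ → Fin.any? λ y′ →
        treePair? (x , y) ×-dec P? (x′ , y′) ×-dec (x ⊕ x′ Fin.≟ h) ×-dec (y ⊕ y′ Fin.≟ h′))
    (λ { (inj₁ (refl , refl)) → [] , [] , [] , refl , refl
       ; (inj₂ (_ , _ , _ , _ , (u , v , p , refl , refl) , (s , t , ps , refl , refl) , refl , refl)) →
           u ∷ s , v ∷ t , p ∷ ps , refl , refl })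
    (λ { P closed (_ , _ , ps , refl , refl) → least P closed ps })
    where
    Step : (Fin nH × Fin nH → Set) → Fin nH × Fin nH → Set
    Step P (h , h′) = (𝟘 ≡ h × 𝟘 ≡ h′)
      ⊎ (∃ λ x → ∃ λ y → ∃ λ x′ → ∃ λ y′ →
           TreePair n (x , y) × P (x′ , y′) × x ⊕ x′ ≡ h × y ⊕ y′ ≡ h′)

    least : ∀ P → Step P ⊆ P → ∀ {s t} → Pointwise (Aligned n) s t → P (⟦ s ⟧ , ⟦ t ⟧)
    least P closed []       = closed (inj₁ (refl , refl))
    least P closed (p ∷ ps) =
      closed (inj₂ (_ , _ , _ , _ , (_ , _ , p , refl , refl) , least P closed ps , refl , refl))

  -- At depth 0 any two tree values form a pair; at depth n + 1 a tree pair arises from a forest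
  -- pair of depth n by putting the same letter above both sides.
  treePair?   : ∀ n → Decidable (TreePair n)
  forestPair? : ∀ n → Decidable (ForestPair n)

  treePair? zero (x , y) = map′
    (λ ((u , e) , (v , e′)) → u , v , tt , e , e′)
    (λ (u , v , _ , e , e′) → (u , e) , (v , e′))
    (isTreeValue? x ×-dec isTreeValue? y)
  treePair? (suc n) (x , y) = map′
    (λ { (a , _ , _ , (s , t , ps , refl , refl) , refl , refl) →
           node a s , node a t , (refl , ps) , refl , refl })
    (λ { (node a s , node .a t , (refl , ps) , refl , refl) →
           a , _ , _ , (s , t , ps , refl , refl) , refl , refl })
    (Fin.any? λ a → Fin.any? λ h → Fin.any? λ h′ →
      forestPair? n (h , h′) ×-dec (act h (g a) Fin.≟ x) ×-dec (act h′ (g a) Fin.≟ y))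

  forestPair? n = forestPair?-from n (treePair? n)

  ForestPair-zero : ∀ n → ForestPair n ⊆ ForestPair 0
  ForestPair-zero n (s , t , ps , e) = s , t , Pointwise.map (λ _ → tt) ps , e

  -- Alignment of two roots constrains their child forests only through alignment one level lower,
  -- so these may be replaced by forests with the same values aligned to the other depth. Values of
  -- the whole forests are unchanged.
  ForestPair-suc : ∀ {m n} → ForestPair m ⊆ ForestPair n → ForestPair (suc m) ⊆ ForestPair (suc n)
  ForestPair-suc {m} {n} m⊆n (_ , _ , ps , refl , refl) = go ps
    where
    go : ∀ {s t} → Pointwise (Aligned (suc m)) s t → ForestPair (suc n) (⟦ s ⟧ , ⟦ t ⟧)
    go [] = [] , [] , [] , refl , refl
    go (_∷_ {x = node a us} {y = node .a vs} (refl , qs) ps)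
      with m⊆n (us , vs , qs , refl , refl) | go ps
    ... | us′ , vs′ , qs′ , e , e′ | s′ , t′ , ps′ , f , f′ =
      node a us′ ∷ s′ , node a vs′ ∷ t′ , (refl , qs′) ∷ ps′ ,
      cong₂ (λ h x → act h (g a) ⊕ x) e f , cong₂ (λ h x → act h (g a) ⊕ x) e′ f′

  ForestPair-descending : ∀ n → ForestPair (suc n) ⊆ ForestPair n
  ForestPair-descending zero    = ForestPair-zero 1
  ForestPair-descending (suc n) = ForestPair-suc (ForestPair-descending n)

  -- Stability lifts a pair from stage `N` to stage N + 1, and `ForestPair-suc` applied to the
  -- induction hypothesis carries it on to stage n + 1. Hence stage `N` is the smallest of all.
  ForestPair-below : ∀ N → ForestPair N ⊆ ForestPair (suc N) → ∀ n → ForestPair N ⊆ ForestPair n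
  ForestPair-below N stable zero    p = ForestPair-zero N p
  ForestPair-below N stable (suc n) p = ForestPair-suc (ForestPair-below N stable n) (stable p)

  -- Abstract because unfolding the bound runs the whole fixpoint computation.
  abstract
    stabilisation : ∃ λ N → ForestPair N ⊆ ForestPair (suc N)
    stabilisation =
      descending-chain-stabilises pairs ∈-pairs ForestPair forestPair? ForestPair-descending

  N : ℕ
  N = proj₁ stabilisation

  ForestPair-N : ∀ n → ForestPair N ⊆ ForestPair n
  ForestPair-N = ForestPair-below N (proj₂ stabilisation)

  -- Conditions (I) and (E) on values, and their equivalence with local testability

  IdempotentAt : Fin nH → Fin nV → Set
  IdempotentAt h o = X (act (h ⊕ h) o) ≡ X (act h o)

  ExchangeAt : Fin nH → Fin nH → Fin nV → Fin nV → Fin nV → Set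
  ExchangeAt h h′ w w′ o =
    X (act (act h w ⊕ act h′ w′) o) ≡ X (act (act (h ⊕ h′) w ⊕ act (h ⊕ h′) w′) o)

  -- The homomorphism need not be onto, so (I) and (E) are tested only on values that forests and
  -- contexts take.
  IdempotentValues : Set
  IdempotentValues = ∀ h → IsForestValue h → ∀ o → IsContextValue o → IdempotentAt h o

  ExchangeValues : Set
  ExchangeValues = ∀ h h′ → ForestPair N (h , h′) → ∀ w → IsContextValue w →
    ∀ w′ → IsContextValue w′ → ∀ o → IsContextValue o → ExchangeAt h h′ w w′ o

  everyContextValue? : ∀ {P : Fin nV → Set} → Decidable P → Dec (∀ v → IsContextValue v → P v)
  everyContextValue? P? = Fin.all? λ v → isContextValue? v →-dec P? v

  conditions? : Dec (IdempotentValues × ExchangeValues)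
  conditions? =
    (Fin.all? λ h → isForestValue? h →-dec everyContextValue? λ o → idempotentAt? h o)
    ×-dec
    (Fin.all? λ h → Fin.all? λ h′ → forestPair? N (h , h′) →-dec
     everyContextValue? λ w → everyContextValue? λ w′ → everyContextValue? λ o →
     exchangeAt? h h′ w w′ o)
    where
    idempotentAt? : ∀ h o → Dec (IdempotentAt h o)
    idempotentAt? h o = X _ Bool.≟ X _
    exchangeAt? : ∀ h h′ w w′ o → Dec (ExchangeAt h h′ w w′ o)
    exchangeAt? h h′ w w′ o = X _ Bool.≟ X _

  ⟦⟧-exchangeˡ : ∀ C D s t → ⟦ plug C s ++ plug D t ⟧ ≡ act ⟦ s ⟧ (val C) ⊕ act ⟦ t ⟧ (val D)
  ⟦⟧-exchangeˡ C D s t = trans (⟦⟧-++ (plug C s) _) (cong₂ _⊕_ (⟦⟧-plug C s) (⟦⟧-plug D t))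

  ⟦⟧-exchangeʳ : ∀ C D s t → ⟦ plug C (s ++ t) ++ plug D (s ++ t) ⟧ ≡
                 act (⟦ s ⟧ ⊕ ⟦ t ⟧) (val C) ⊕ act (⟦ s ⟧ ⊕ ⟦ t ⟧) (val D)
  ⟦⟧-exchangeʳ C D s t =
    trans (⟦⟧-exchangeˡ C D (s ++ t) (s ++ t))
          (cong (λ h → act h (val C) ⊕ act h (val D)) (⟦⟧-++ s t))

  LocallyTestable⇒conditions :
    LocallyTestable (Recognised F g X) → IdempotentValues × ExchangeValues
  LocallyTestable⇒conditions (n , testable) = idempotentValues , exchangeValues
    where
    Equiv⇒≈ : ∀ {s t} → Equiv (suc n) s t → s ≈ t
    Equiv⇒≈ e = mk≈ λ O → Bool.⇔→≡ (mk⇔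
      (testable _ _ (Equiv-plug n O e))
      (testable _ _ (Equiv-plug n O (≃-sym n (proj₁ e) , ≃-sym (suc n) (proj₂ e)))))

    idempotentValues : IdempotentValues
    idempotentValues _ (s , refl) _ (O , refl) =
      trans (cong (λ h → X (act h (val O))) (sym (⟦⟧-++ s s))) (≈⇒≡ (Equiv⇒≈ (Equiv-idem n s)) O)

    exchangeValues : ExchangeValues
    exchangeValues h h′ p _ (C , refl) _ (D , refl) _ (O , refl)
      -- The pair comes from forests aligned to depth `N`, but testability is given for `n`, which
      -- may be larger. Stability supplies forests with the same values aligned to depth `n`.
      with ForestPair-N n p
    ... | s , t , ps , refl , refl =
      subst₂ (λ x y → X (act x (val O)) ≡ X (act y (val O)))
        (⟦⟧-exchangeˡ C D s t) (⟦⟧-exchangeʳ C D s t)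
        (≈⇒≡ (Equiv⇒≈ (Equiv-exchange n C D (Aligned⇒≃ n ps))) O)

  conditions⇒LocallyTestable :
    IdempotentValues × ExchangeValues → LocallyTestable (Recognised F g X)
  conditions⇒LocallyTestable (idempotentValues , exchangeValues) =
    -- The witness `N` means level N + 1; the empty context turns indistinguishability into equal
    -- membership.
    N , λ s t e Ls → trans (sym (indistinguishable (Equiv⇒≈ e) □)) Ls
    where
    idem : ∀ s → (s ++ s) ≈ s
    idem s = ≡⇒≈ λ O → trans (cong (λ h → X (act h (val O))) (⟦⟧-++ s s))
                             (idempotentValues _ (s , refl) _ (O , refl))

    open Idempotent idem

    exchange : ∀ C D {s t} → s ≃[ N ] t →
               (plug C s ++ plug D t) ≈ (plug C (s ++ t) ++ plug D (s ++ t))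
    -- (E) is known only for values of aligned forests, so `s` and `t` are first replaced by
    -- indistinguishable aligned ones.
    exchange C D {s} {t} s≃t with align-forest N s≃t
    ... | s′ , t′ , ps , s≈s′ , t≈t′ = begin
      plug C s ++ plug D t                   ≈⟨ ++-cong (≈-plug C s≈s′) (≈-plug D t≈t′) ⟩
      plug C s′ ++ plug D t′                 ≈⟨ ≡⇒≈ (λ O →
        subst₂ (λ x y → X (act x (val O)) ≡ X (act y (val O)))
          (sym (⟦⟧-exchangeˡ C D s′ t′)) (sym (⟦⟧-exchangeʳ C D s′ t′))
          (exchangeValues _ _ (s′ , t′ , ps , refl , refl)
             _ (C , refl) _ (D , refl) _ (O , refl))) ⟩
      plug C (s′ ++ t′) ++ plug D (s′ ++ t′) ≈⟨ ++-cong (≈-plug C st≈) (≈-plug D st≈) ⟨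
      plug C (s ++ t) ++ plug D (s ++ t)     ∎
      where
      open import Relation.Binary.Reasoning.Setoid setoid
      st≈ = ++-cong s≈s′ t≈t′

    open Exchange N exchange

theorem8 : {k : ℕ} (F : FiniteForestAlgebra)
    (g : Fin k → Fin (FiniteForestAlgebra.nV F))
    (X : Fin (FiniteForestAlgebra.nH F) → Bool) →
    Dec (LocallyTestable (Recognised F g X))
theorem8 F g X = map′ conditions⇒LocallyTestable LocallyTestable⇒conditions conditions?
  where open Recognition F g X
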